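{- Let $\mathcal{L}$ be an abstract logic such that $\mathcal{L}^-_{\omega\omega}\leq\mathcal{L}$. If $\mathcal{L}$ has the weak isomorphism property, the compactness property and the Löwenheim–Skolem property, then $\mathcal{L}\leq\mathcal{L}^-_{\omega\omega}$.
   Context: $\mathcal{L}^-_{\omega\omega}$ denotes first-order logic without identity. An abstract logic $\mathcal{L}$ assigns to each vocabulary $\tau$ a set of sentences $\mathcal{L}(\tau)$ and a satisfaction relation with $\tau$-structures, satisfying the basic closure properties of abstract logics in the sense of Barwise–Feferman (isomorphism, reduct/expansion, renaming, closure under Boolean connectives, etc.), with the atom property taken relative to $\mathcal{L}^-_{\omega\omega}$; relativization is not required. $\mathcal{L}\leq\mathcal{L}'$ means that for every vocabulary $\tau$ every sentence of $\mathcal{L}(\tau)$ is equivalent to some sentence of $\mathcal{L}'(\tau)$. Compactness property: for every $\tau$ and $\Phi\subseteq\mathcal{L}(\tau)$, if every finite subset of $\Phi$ has a model then $\Phi$ has a model. Löwenheim–Skolem property: every sentence of $\mathcal{L}(\tau)$ with an infinite model has a countable model. A weak isomorphism between $\tau$-structures $\mathfrak{A},\mathfrak{B}$ is a relation $R\subseteq A\times B$ with domain $A$ and range $B$ such that whenever $a_iRb_i$ ($i\le n$): $P^{\mathfrak{A}}(\bar a)$ iff $P^{\mathfrak{B}}(\bar b)$ for each $n$-ary relation symbol $P$, $f^{\mathfrak{A}}(\bar a)\,R\,f^{\mathfrak{B}}(\bar b)$ for each $n$-ary function symbol $f$, and $c^{\mathfrak{A}}Rc^{\mathfrak{B}}$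 for each constant $c$; $\mathfrak{A}\sim\mathfrak{B}$ means such $R$ exists. Weak isomorphism property: $\mathfrak{A}\sim\mathfrak{B}$ implies $\mathfrak{A}$ and $\mathfrak{B}$ satisfy the same $\mathcal{L}$-sentences. -}

module Defs where

open import Level using (Level; 0ℓ; _⊔_) renaming (suc to lsuc)
open import Data.Empty using (⊥)
open import Data.Fin.Base using (Fin; zero; suc)
open import Data.List.Base using (List)
open import Data.List.Relation.Unary.All using (All)
open import Data.Maybe.Base using (Maybe; maybe′)
open import Data.Nat.Base using (ℕ; suc)
open import Data.Product.Base using (Σ-syntax; ∃-syntax; _×_)
open import Data.Vec.Base using (Vec; []; _∷_; map)
open import Data.Vec.Relation.Binary.Pointwise.Inductive using (Pointwise)
open import Function.Bundles using (_↔_; _↣_; _⇔_; module Inverse; module Injection)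
open import Relation.Binary.PropositionalEquality.Core using (_≡_)
open import Relation.Nullary.Negation.Core using (¬_)
open import Relation.Unary using (Pred; _∈_)

------------------------------------------------------------------------
-- Vocabularies

record Vocabulary : Set₁ where
  field
    Rel   : ℕ → Set
    Fun   : ℕ → Set
    Const : Set

open Vocabulary public

-- An injective, kind- and arity-preserving map of symbols.  Inclusions
-- τ ⊆ σ are the typical instance; the bijective ones are renamings.

record _↪ᵥ_ (τ σ : Vocabulary) : Set where
  field
    onRel   : ∀ {n} → Rel τ n ↣ Rel σ n
    onFun   : ∀ {n} → Fun τ n ↣ Fun σ n
    onConst : Const τ ↣ Const σ

-- τ together with one new constant symbol, `nothing`.

_+const : Vocabulary → Vocabulary
τ +const = record { Rel = Rel τ ; Fun = Fun τ ; Const = Maybe (Const τ) }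

------------------------------------------------------------------------
-- Structures

record Structure (τ : Vocabulary) : Set₁ where
  field
    Carrier    : Set
    inhabitant : Carrier   -- only witnesses that the universe is nonempty
    rel        : ∀ {n} → Rel τ n → Vec Carrier n → Set
    fun        : ∀ {n} → Fun τ n → Vec Carrier n → Carrier
    const      : Const τ → Carrier

open Structure public

-- With e an inclusion this is the usual reduct A ↾ τ; with e a renaming
-- it is A with its symbols renamed by the inverse of e.

reduct : ∀ {τ σ} → τ ↪ᵥ σ → Structure σ → Structure τ
reduct e A = record
  { Carrier    = Carrier A
  ; inhabitant = inhabitant A
  ; rel        = λ P → rel A (Injection.to onRel P)
  ; fun        = λ f → fun A (Injection.to onFun f)
  ; const      = λ c → const A (Injection.to onConst c)
  } where open _↪ᵥ_ e

-- The expansion (A , a) in which the new constant denotes a.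

_,const_ : ∀ {τ} (A : Structure τ) → Carrier A → Structure (τ +const)
A ,const a = record
  { Carrier    = Carrier A
  ; inhabitant = inhabitant A
  ; rel        = rel A
  ; fun        = fun A
  ; const      = maybe′ (const A) a
  }

record _≅_ {τ} (A B : Structure τ) : Set where
  field
    bijection : Carrier A ↔ Carrier B
  open Inverse bijection using (to) public
  field
    rel-iso   : ∀ {n} (P : Rel τ n) as → rel A P as ⇔ rel B P (map to as)
    fun-iso   : ∀ {n} (f : Fun τ n) as → to (fun A f as) ≡ fun B f (map to as)
    const-iso : ∀ c → to (const A c) ≡ const B c

record IsWeakIsomorphism {τ} (A B : Structure τ)
                         (R : Carrier A → Carrier B → Set) : Set where
  field
    domain     : ∀ a → ∃[ b ] R a b
    range      : ∀ b → ∃[ a ] R a b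
    rel-weak   : ∀ {n} (P : Rel τ n) {as bs} → Pointwise R as bs →
                 rel A P as ⇔ rel B P bs
    fun-weak   : ∀ {n} (f : Fun τ n) {as bs} → Pointwise R as bs →
                 R (fun A f as) (fun B f bs)
    const-weak : ∀ c → R (const A c) (const B c)

_∼_ : ∀ {τ} → Structure τ → Structure τ → Set₁
A ∼ B = ∃[ R ] IsWeakIsomorphism A B R

Infinite : Set → Set
Infinite X = ¬ (∃[ n ] (X ↔ Fin n))

-- At most countable: finite universes are included.

Countable : Set → Set
Countable X = X ↣ ℕ

------------------------------------------------------------------------
-- Logics

-- The bare data; the closure properties are in IsAbstractLogic.

record Logic (v : Level) : Set (lsuc (0ℓ ⊔ v)) where
  infix 4 _⊨_
  field
    Sentence : Vocabulary → Set
    _⊨_      : ∀ {τ} → Structure τ → Sentence τ → Set v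

infix 4 _≤ᴸ_

_≤ᴸ_ : ∀ {v w} → Logic v → Logic w → Set (lsuc 0ℓ ⊔ v ⊔ w)
L ≤ᴸ L′ = ∀ {τ} (φ : L.Sentence τ) →
  Σ[ ψ ∈ L′.Sentence τ ] (∀ (A : Structure τ) → A L.⊨ φ ⇔ A L′.⊨ ψ)
  where
  module L  = Logic L
  module L′ = Logic L′

------------------------------------------------------------------------
-- First-order logic without identity

-- Terms and formulas with free variables (de Bruijn indices) in Fin k.

data Term (τ : Vocabulary) (k : ℕ) : Set where
  var : Fin k → Term τ k
  con : Const τ → Term τ k
  app : ∀ {n} → Fun τ n → Vec (Term τ k) n → Term τ k

-- `falsum` is primitive: without identity, a vocabulary with no relation
-- symbols has no atomic formulas, and would otherwise have no sentences.
-- The other connectives and ∀ are definable classically.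

data Formula (τ : Vocabulary) (k : ℕ) : Set where
  falsum : Formula τ k
  atom   : ∀ {n} → Rel τ n → Vec (Term τ k) n → Formula τ k
  neg    : Formula τ k → Formula τ k
  conj   : Formula τ k → Formula τ k → Formula τ k
  ex     : Formula τ (suc k) → Formula τ k

Assignment : ∀ {τ} → Structure τ → ℕ → Set
Assignment A k = Fin k → Carrier A

module _ {τ} (A : Structure τ) where

  empty : Assignment A 0
  empty ()

  extend : ∀ {k} → Carrier A → Assignment A k → Assignment A (suc k)
  extend a ρ zero    = a
  extend a ρ (suc i) = ρ i

  eval  : ∀ {k} → Assignment A k → Term τ k → Carrier A
  evals : ∀ {k n} → Assignment A k → Vec (Term τ k) n → Vec (Carrier A) n

  eval ρ (var i)    = ρ i
  eval ρ (con c)    = const A c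
  eval ρ (app f ts) = fun A f (evals ρ ts)

  evals ρ []       = []
  evals ρ (t ∷ ts) = eval ρ t ∷ evals ρ ts

  satisfies : ∀ {k} → Assignment A k → Formula τ k → Set
  satisfies ρ falsum      = ⊥
  satisfies ρ (atom P ts) = rel A P (evals ρ ts)
  satisfies ρ (neg φ)     = ¬ satisfies ρ φ
  satisfies ρ (conj φ ψ)  = satisfies ρ φ × satisfies ρ ψ
  satisfies ρ (ex φ)      = ∃[ a ] satisfies (extend a ρ) φ

𝓛⁻ωω : Logic 0ℓ
𝓛⁻ωω = record
  { Sentence = λ τ → Formula τ 0
  ; _⊨_      = λ A φ → satisfies A (empty A) φ
  }

------------------------------------------------------------------------
-- Properties of logics

module _ {v} (L : Logic v) where

  open Logic L

  record IsAbstractLogic : Set (lsuc 0ℓ ⊔ v) where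
    field
      isomorphism : ∀ {τ} {A B : Structure τ} (φ : Sentence τ) →
        A ≅ B → A ⊨ φ → B ⊨ φ

      -- For inclusions this says that L(τ) ⊆ L(σ) and that satisfaction
      -- is unaffected by expansions and reducts; for bijective e it is
      -- the renaming property.
      translation : ∀ {τ σ} (e : τ ↪ᵥ σ) (φ : Sentence τ) →
        Σ[ ψ ∈ Sentence σ ] (∀ A → A ⊨ ψ ⇔ reduct e A ⊨ φ)

      -- Atomic sentences of 𝓛⁻ωω only, so no equations.
      atomic : ∀ {τ n} (P : Rel τ n) (ts : Vec (Term τ 0) n) →
        Σ[ ψ ∈ Sentence τ ]
          (∀ A → A ⊨ ψ ⇔ Logic._⊨_ 𝓛⁻ωω A (atom P ts))

      negation : ∀ {τ} (φ : Sentence τ) →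
        Σ[ ψ ∈ Sentence τ ] (∀ A → A ⊨ ψ ⇔ (¬ (A ⊨ φ)))

      conjunction : ∀ {τ} (φ χ : Sentence τ) →
        Σ[ ψ ∈ Sentence τ ] (∀ A → A ⊨ ψ ⇔ (A ⊨ φ × A ⊨ χ))

      particularization : ∀ {τ} (φ : Sentence (τ +const)) →
        Σ[ ψ ∈ Sentence τ ] (∀ A → A ⊨ ψ ⇔ (∃[ a ] (A ,const a) ⊨ φ))

  WeakIsomorphismProperty : Set (lsuc 0ℓ ⊔ v)
  WeakIsomorphismProperty = ∀ {τ} {A B : Structure τ} → A ∼ B →
    ∀ (φ : Sentence τ) → A ⊨ φ ⇔ B ⊨ φ

  CompactnessProperty : Set (lsuc 0ℓ ⊔ v)
  CompactnessProperty = ∀ {τ} (Φ : Pred (Sentence τ) 0ℓ) →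
    (∀ (Γ : List (Sentence τ)) → All (_∈ Φ) Γ →
      Σ[ A ∈ Structure τ ] All (A ⊨_) Γ) →
    Σ[ A ∈ Structure τ ] (∀ φ → φ ∈ Φ → A ⊨ φ)

  LöwenheimSkolemProperty : Set (lsuc 0ℓ ⊔ v)
  LöwenheimSkolemProperty = ∀ {τ} (φ : Sentence τ) →
    (Σ[ A ∈ Structure τ ] (Infinite (Carrier A) × A ⊨ φ)) →
    Σ[ A ∈ Structure τ ] (Countable (Carrier A) × A ⊨ φ)

{-# OPTIONS --safe #-}

-- Two structures A ⊨ φ and B ⊨ ¬φ can be pulled back along the projections of
-- A × B without leaving their weak isomorphism classes, so they live on one
-- universe and no relativization is needed to speak about both in one
-- vocabulary (two copies of τ).  Compactness applied to "W is a weak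
-- isomorphism" shows that φ depends on finitely many symbols; hence a
-- back-and-forth system for these symbols is described by a single sentence,
-- has by Löwenheim–Skolem a countable model, and there an increasing chain of
-- stages yields a weak isomorphism.  So φ transfers along back-and-forth
-- systems.  Compactness once more: φ transfers already under finitely many of
-- the axioms for "linked tuples" of lengths 0, 1, 2, …, and these are satisfied
-- by the agreement on finitely many Hintikka formulas.  A sentence invariant
-- under agreement on finitely many first-order sentences is a Boolean
-- combination of them.
--
-- No choice principle beyond excluded middle is needed: ∃ is a Σ-type, so a
-- stable ∀∃ statement already provides the choice function.

module Submission where

open import Defs
open import Level using (0ℓ; _⊔_; Lift; lift; lower) renaming (suc to lsuc)
open import Axiom.ExcludedMiddle using (ExcludedMiddle)
open import Data.Empty using (⊥; ⊥-elim)
open import Data.Fin.Base using (Fin; zero; suc; toℕ)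
open import Data.Fin.Properties using (injective⇒≤; toℕ-injective)
open import Data.List.Base using (List; []; _∷_; _++_; map; concatMap; catMaybes)
open import Data.List.Extrema.Nat using (max; xs≤max)
open import Data.List.Membership.Propositional renaming (_∈_ to _∈ᴸ_)
open import Data.List.Membership.Propositional.Properties
  using (∈-map⁺; ∈-map⁻; ∈-++⁺ˡ; ∈-++⁺ʳ; ∈-++⁻; ∈-concatMap⁺)
open import Data.List.Relation.Unary.All as All using (All; []; _∷_)
open import Data.List.Relation.Unary.Any as Any using (here; there)
open import Data.Maybe.Base using (Maybe; just; nothing)
open import Data.Nat.Base using (ℕ; zero; suc; _+_; _*_; _∸_; _≤_; _≤′_; ≤′-refl; ≤′-step)
  renaming (_⊔_ to _⊔ℕ_)
open import Data.Nat.Properties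
  using (_≟_; 1+n≰n; m≤m⊔n; m≤n⊔m; ≤⇒≤′; +-∸-assoc)
open import Data.Product.Base using (Σ; Σ-syntax; ∃-syntax; _×_; _,_; proj₁; proj₂; uncurry)
open import Data.Product.Function.NonDependent.Propositional using (_×-⇔_)
open import Data.Sum.Base using (_⊎_; inj₁; inj₂)
open import Data.Sum.Properties using (inj₁-injective; inj₂-injective)
open import Data.Unit.Base using (⊤; tt)
open import Data.Vec.Base as Vec using (Vec; []; _∷_)
open import Data.Vec.Relation.Binary.Pointwise.Inductive as Pointwise
  using (Pointwise; []; _∷_)
open import Function.Base using (id; _∘_; case_of_)
open import Function.Bundles
  using (_⇔_; mk⇔; _↣_; mk↣; module Equivalence; module Injection; module Inverse)
open import Function.Construct.Composition using (_⇔-∘_)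
open import Function.Construct.Identity using (⇔-id; ↣-id)
open import Function.Construct.Symmetry using (⇔-sym)
open import Function.Properties.Inverse using (↔⇒↣)
open import Function.Related.TypeIsomorphisms using (→-cong-⇔)
open import Relation.Binary.PropositionalEquality.Core
  using (_≡_; refl; sym; trans; cong; cong₂; subst; subst₂)
open import Relation.Nullary.Decidable.Core using (yes; no; map′; decidable-stable)
open import Relation.Nullary.Negation.Core using (¬_)
open import Relation.Unary using (Pred; _∈_)

open Equivalence using (to; from)

≡⇒⇔ : ∀ {ℓ} {P Q : Set ℓ} → P ≡ Q → P ⇔ Q
≡⇒⇔ refl = ⇔-id _

-- Terms, assignments and definability

assign : ∀ {τ k} (A : Structure τ) → Vec (Carrier A) k → Assignment A k
assign A []      = empty A
assign A (a ∷ v) = extend A a (assign A v)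

idᵥ : ∀ {τ} → τ ↪ᵥ τ
idᵥ = record { onRel = ↣-id _ ; onFun = ↣-id _ ; onConst = ↣-id _ }

module _ {τ σ} (e : τ ↪ᵥ σ) where

  open _↪ᵥ_ e

  rename  : ∀ {k m} → (Fin k → Fin m) → Term τ k → Term σ m
  renames : ∀ {k m n} → (Fin k → Fin m) → Vec (Term τ k) n → Vec (Term σ m) n

  rename g (var i)    = var (g i)
  rename g (con c)    = con (Injection.to onConst c)
  rename g (app f ts) = app (Injection.to onFun f) (renames g ts)

  renames g []       = []
  renames g (t ∷ ts) = rename g t ∷ renames g ts

  module _ (M : Structure σ) {k m} {ρ : Assignment M m}
           {ρ′ : Assignment (reduct e M) k} (g : Fin k → Fin m)
           (eq : ∀ i → ρ (g i) ≡ ρ′ i) where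

    -- Symbols and variables change together, so one lemma covers both weakening (`idᵥ` with `suc`)
    -- and the translation of a term into one half of a pair (`inˡ` with `fstᵢ`).
    eval-rename   : ∀ t → eval M ρ (rename g t) ≡ eval (reduct e M) ρ′ t
    evals-renames : ∀ {n} (ts : Vec (Term τ k) n) →
      evals M ρ (renames g ts) ≡ evals (reduct e M) ρ′ ts

    eval-rename (var i)    = eq i
    eval-rename (con c)    = refl
    eval-rename (app f ts) = cong (fun M (Injection.to onFun f)) (evals-renames ts)

    evals-renames []       = refl
    evals-renames (t ∷ ts) = cong₂ _∷_ (eval-rename t) (evals-renames ts)

vars : ∀ {τ} n → Vec (Term τ n) n
vars zero    = []
vars (suc n) = var zero ∷ renames idᵥ suc (vars n)

evals-vars : ∀ {τ n} (A : Structure τ) (v : Vec (Carrier A) n) →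
  evals A (assign A v) (vars n) ≡ v
evals-vars A []      = refl
evals-vars A (a ∷ v) =
  cong (a ∷_) (trans (evals-renames idᵥ A suc (λ _ → refl) (vars _)) (evals-vars A v))

-- A vector of length 2k codes two vectors of length k, interleaved.

fsts snds : ∀ {X : Set} k → Vec X (k * 2) → Vec X k
fsts zero    []          = []
fsts (suc k) (x ∷ y ∷ v) = x ∷ fsts k v
snds zero    []          = []
snds (suc k) (x ∷ y ∷ v) = y ∷ snds k v

fstᵢ sndᵢ : ∀ {k} → Fin k → Fin (k * 2)
fstᵢ zero    = zero
fstᵢ (suc i) = suc (suc (fstᵢ i))
sndᵢ zero    = suc zero
sndᵢ (suc i) = suc (suc (sndᵢ i))

module _ {τ σ} (e : τ ↪ᵥ σ) (M : Structure σ) where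

  assign-fstᵢ : ∀ k v i → assign M v (fstᵢ {k} i) ≡ assign (reduct e M) (fsts k v) i
  assign-fstᵢ (suc k) (x ∷ y ∷ v) zero    = refl
  assign-fstᵢ (suc k) (x ∷ y ∷ v) (suc i) = assign-fstᵢ k v i

  assign-sndᵢ : ∀ k v i → assign M v (sndᵢ {k} i) ≡ assign (reduct e M) (snds k v) i
  assign-sndᵢ (suc k) (x ∷ y ∷ v) zero    = refl
  assign-sndᵢ (suc k) (x ∷ y ∷ v) (suc i) = assign-sndᵢ k v i

interleave : ∀ {X : Set} {k} (xs ys : Vec X k) →
  Σ[ v ∈ Vec X (k * 2) ] fsts k v ≡ xs × snds k v ≡ ys
interleave []       []       = [] , refl , refl
interleave (x ∷ xs) (y ∷ ys) with interleave xs ys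
... | v , refl , refl = x ∷ y ∷ v , refl , refl

-- Formulas are built together with their meaning, so that axioms can be stated semantically and
-- their codes need not be read.
record Definable {σ k} (Q : (M : Structure σ) → Vec (Carrier M) k → Set) : Set₁ where
  field
    formula : Formula σ k
    defines : ∀ M v → satisfies M (assign M v) formula ⇔ Q M v

open Definable

module _ {σ : Vocabulary} where

  respᵈ : ∀ {k} {Q Q′ : (M : Structure σ) → Vec (Carrier M) k → Set} →
    (∀ M v → Q M v ⇔ Q′ M v) → Definable Q → Definable Q′
  respᵈ Q⇔Q′ D = record
    { formula = formula D
    ; defines = λ M v → Q⇔Q′ M v ⇔-∘ defines D M v
    }

  atomᵈ : ∀ {k n} (P : Rel σ n) (ts : Vec (Term σ k) n) →
    Definable (λ M v → rel M P (evals M (assign M v) ts))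
  atomᵈ P ts = record { formula = atom P ts ; defines = λ M v → ⇔-id _ }

  ⊤ᵈ : ∀ {k} → Definable {σ} {k} (λ M v → ⊤)
  ⊤ᵈ = record { formula = neg falsum ; defines = λ M v → mk⇔ _ (λ _ ()) }

  module _ {k} {Q Q′ : (M : Structure σ) → Vec (Carrier M) k → Set} where

    _×ᵈ_ : Definable Q → Definable Q′ → Definable (λ M v → Q M v × Q′ M v)
    D ×ᵈ D′ = record
      { formula = conj (formula D) (formula D′)
      ; defines = λ M v → defines D M v ×-⇔ defines D′ M v
      }

  ∃ᵈ : ∀ {k} {Q : (M : Structure σ) → Vec (Carrier M) (suc k) → Set} →
    Definable Q → Definable (λ M v → ∃[ a ] Q M (a ∷ v))
  ∃ᵈ D = record
    { formula = ex (formula D)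
    ; defines = λ M v → mk⇔ (λ (a , p) → a , to (defines D M (a ∷ v)) p)
                            (λ (a , p) → a , from (defines D M (a ∷ v)) p)
    }

  ⋀ᵈ : ∀ {k n} {Q : Fin n → (M : Structure σ) → Vec (Carrier M) k → Set} →
    (∀ i → Definable (Q i)) → Definable (λ M v → ∀ i → Q i M v)
  ⋀ᵈ {n = zero}  D = respᵈ (λ M v → mk⇔ (λ _ ()) _) ⊤ᵈ
  ⋀ᵈ {n = suc n} D = respᵈ
    (λ M v → mk⇔ (λ (p , q) → λ { zero → p ; (suc i) → q i })
                 (λ p → p zero , p ∘ suc))
    (D zero ×ᵈ ⋀ᵈ (D ∘ suc))

  Allᵈ : ∀ {k} {I : Set} {Q : I → (M : Structure σ) → Vec (Carrier M) k → Set} →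
    (∀ i → Definable (Q i)) → ∀ is → Definable (λ M v → All (λ i → Q i M v) is)
  Allᵈ D []       = respᵈ (λ M v → mk⇔ (λ _ → []) _) ⊤ᵈ
  Allᵈ D (i ∷ is) = respᵈ
    (λ M v → mk⇔ (uncurry _∷_) (λ { (p ∷ ps) → p , ps })) (D i ×ᵈ Allᵈ D is)

-- Classical connectives and quantifiers

module ClassicalDefinability (em : ExcludedMiddle 0ℓ) {σ : Vocabulary} where

  module _ {k} {Q Q′ : (M : Structure σ) → Vec (Carrier M) k → Set} where

    _→ᵈ_ : Definable Q → Definable Q′ → Definable (λ M v → Q M v → Q′ M v)
    D →ᵈ D′ = record
      { formula = neg (conj (formula D) (neg (formula D′)))
      ; defines = λ M v → →-cong-⇔ (defines D M v) (defines D′ M v) ⇔-∘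
          mk⇔ (λ h p → decidable-stable em (λ ¬q → h (p , ¬q))) (λ h (p , ¬q) → ¬q (h p))
      }

  module _ {k} {Q Q′ : (M : Structure σ) → Vec (Carrier M) k → Set} where

    _⇔ᵈ_ : Definable Q → Definable Q′ → Definable (λ M v → Q M v ⇔ Q′ M v)
    D ⇔ᵈ D′ = respᵈ (λ M v → mk⇔ (λ (f , g) → mk⇔ f g) (λ h → to h , from h))
      ((D →ᵈ D′) ×ᵈ (D′ →ᵈ D))

  ∀ᵈ : ∀ {k} {Q : (M : Structure σ) → Vec (Carrier M) (suc k) → Set} →
    Definable Q → Definable (λ M v → ∀ a → Q M (a ∷ v))
  ∀ᵈ D = record
    { formula = neg (ex (neg (formula D)))
    ; defines = λ M v → mk⇔
        (λ h a → decidable-stable em (λ ¬q → h (a , ¬q ∘ to (defines D M (a ∷ v)))))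
        (λ h (a , ¬p) → ¬p (from (defines D M (a ∷ v)) (h a)))
    }

  ∀*ᵈ : ∀ {k} {Q : (M : Structure σ) → Vec (Carrier M) k → Set} →
    Definable Q → Definable {σ} {0} (λ M _ → ∀ v → Q M v)
  ∀*ᵈ {zero}  D = respᵈ (λ M → λ { [] → mk⇔ (λ p → λ { [] → p }) (λ h → h []) }) D
  ∀*ᵈ {suc k} D = respᵈ (λ M _ → mk⇔ (λ h → λ { (a ∷ v) → h v a }) (λ h v a → h (a ∷ v)))
    (∀*ᵈ (∀ᵈ D))

-- Pairs of structures on a common universe

-- Relations are read through `p`; the values of functions and constants are sent back by `q`, which
-- will be a section of `p`.
pullback : ∀ {τ} (A : Structure τ) {U : Set} →
  (U → Carrier A) → (Carrier A → U) → Structure τ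
pullback A {U} p q = record
  { Carrier    = U
  ; inhabitant = q (inhabitant A)
  ; rel        = λ P us → rel A P (Vec.map p us)
  ; fun        = λ f us → q (fun A f (Vec.map p us))
  ; const      = λ c → q (const A c)
  }

-- The graph of `p` works: related tuples have the same image in `A`, and the section makes the
-- graph total and compatible with functions and constants.
∼-pullback : ∀ {τ} (A : Structure τ) {U : Set} (p : U → Carrier A) (q : Carrier A → U) →
  (∀ a → p (q a) ≡ a) → A ∼ pullback A p q
∼-pullback A p q pq = (λ a u → a ≡ p u) , record
  { domain     = λ a → q a , sym (pq a)
  ; range      = λ u → p u , refl
  ; rel-weak   = λ P as∼us → ≡⇒⇔ (cong (rel A P) (image as∼us))
  ; fun-weak   = λ f as∼us → trans (cong (fun A f) (image as∼us)) (sym (pq _))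
  ; const-weak = λ c → sym (pq _)
  }
  where
  image : ∀ {n as us} → Pointwise (λ a u → a ≡ p u) {n} {n} as us → as ≡ Vec.map p us
  image []              = refl
  image (refl ∷ as∼us) = cong (_ ∷_) (image as∼us)

_⊎ᵥ_ : Vocabulary → (ℕ → Set) → Vocabulary
τ ⊎ᵥ X = record
  { Rel   = λ n → Rel τ n ⊎ Rel τ n ⊎ X n
  ; Fun   = λ n → Fun τ n ⊎ Fun τ n
  ; Const = Const τ ⊎ Const τ
  }

module _ {τ : Vocabulary} {X : ℕ → Set} where

  inˡ inʳ : τ ↪ᵥ (τ ⊎ᵥ X)
  inˡ = record
    { onRel   = mk↣ inj₁-injective
    ; onFun   = mk↣ inj₁-injective
    ; onConst = mk↣ inj₁-injective
    }
  inʳ = record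
    { onRel   = mk↣ (inj₁-injective ∘ inj₂-injective)
    ; onFun   = mk↣ inj₂-injective
    ; onConst = mk↣ inj₂-injective
    }

  leftOf rightOf : Structure (τ ⊎ᵥ X) → Structure τ
  leftOf  = reduct inˡ
  rightOf = reduct inʳ

  new : (M : Structure (τ ⊎ᵥ X)) → ∀ {n} → X n → Vec (Carrier M) n → Set
  new M x = rel M (inj₂ (inj₂ x))

-- The factor C lets the common universe be infinite and contain stages of a
-- back-and-forth system.

module _ {τ : Vocabulary} (A B : Structure τ) {C : Set} (c : C) where

  fstPullback sndPullback : Structure τ
  fstPullback = pullback A {Carrier A × Carrier B × C} proj₁ (λ a → a , inhabitant B , c)
  sndPullback = pullback B {Carrier A × Carrier B × C} (proj₁ ∘ proj₂) (λ b → inhabitant A , b , c)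

  ∼-fstPullback : A ∼ fstPullback
  ∼-fstPullback = ∼-pullback A proj₁ (λ a → a , inhabitant B , c) (λ _ → refl)

  ∼-sndPullback : B ∼ sndPullback
  ∼-sndPullback = ∼-pullback B (proj₁ ∘ proj₂) (λ b → inhabitant A , b , c) (λ _ → refl)

  -- `leftOf` and `rightOf` of a twin are the two pullbacks by definition; even the chosen
  -- inhabitants coincide.
  twin : ∀ {X : ℕ → Set} →
    (∀ {n} → X n → Vec (Carrier A × Carrier B × C) n → Set) → Structure (τ ⊎ᵥ X)
  twin E = record
    { Carrier    = Carrier A × Carrier B × C
    ; inhabitant = inhabitant A , inhabitant B , c
    ; rel        = λ { (inj₁ P)        → rel fstPullback P
                     ; (inj₂ (inj₁ P)) → rel sndPullback P
                     ; (inj₂ (inj₂ x)) → E x }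
    ; fun        = λ { (inj₁ f) → fun fstPullback f ; (inj₂ f) → fun sndPullback f }
    ; const      = λ { (inj₁ d) → const fstPullback d ; (inj₂ d) → const sndPullback d }
    }

-- Weak isomorphisms, symbol by symbol

data Symbol (τ : Vocabulary) : Set where
  relˢ   : ∀ {n} → Rel τ n → Symbol τ
  funˢ   : ∀ {n} → Fun τ n → Symbol τ
  constˢ : Const τ → Symbol τ

-- The clauses of a weak isomorphism are separated by symbol so that compactness can select finitely
-- many of them.
Preserves : ∀ {τ} (A B : Structure τ) → (Carrier A → Carrier B → Set) → Symbol τ → Set
Preserves A B W (relˢ P)   = ∀ {as bs} → Pointwise W as bs → rel A P as ⇔ rel B P bs
Preserves A B W (funˢ f)   = ∀ {as bs} → Pointwise W as bs → W (fun A f as) (fun B f bs)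
Preserves A B W (constˢ c) = W (const A c) (const B c)

Total Onto : {X Y : Set} → (X → Y → Set) → Set
Total W = ∀ x → ∃[ y ] W x y
Onto  W = ∀ y → ∃[ x ] W x y

weakIsomorphism : ∀ {τ} {A B : Structure τ} {W} →
  Total W → Onto W → (∀ q → Preserves A B W q) → IsWeakIsomorphism A B W
weakIsomorphism total onto pres = record
  { domain     = total
  ; range      = onto
  ; rel-weak   = λ P → pres (relˢ P)
  ; fun-weak   = λ f → pres (funˢ f)
  ; const-weak = λ c → pres (constˢ c)
  }

-- Back-and-forth systems

module _ {S X Y : Set} (R : S → X → Y → Set) where

  infix 4 _⊑_
  -- Stages are names of relations, not relations, so that a whole system can be coded by one
  -- ternary relation inside a structure.
  _⊑_ : S → S → Set
  s ⊑ s′ = ∀ x y → R s x y → R s′ x y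

  Forth Back : Set
  Forth = ∀ s x → ∃[ s′ ] s ⊑ s′ × (∃[ y ] R s′ x y)
  Back  = ∀ s y → ∃[ s′ ] s ⊑ s′ × (∃[ x ] R s′ x y)

module Limit (em : ExcludedMiddle 0ℓ) {S X Y : Set} (ιˣ : X ↣ ℕ) (ιʸ : Y ↣ ℕ)
             (R : S → X → Y → Set) (s₀ : S) (forth : Forth R) (back : Back R) where

  private
    module ιˣ = Injection ιˣ
    module ιʸ = Injection ιʸ

  -- Serves the element with code `n`, which is unique by injectivity; if there is none, the stage
  -- is kept.
  visitˣ : ∀ n s → ∃[ s′ ] (_⊑_ R s s′ × (∀ x → ιˣ.to x ≡ n → ∃[ y ] R s′ x y))
  visitˣ n s with em {∃[ x ] ιˣ.to x ≡ n}
  ... | no  ¬x         = s , (λ _ _ → id) , λ x eq → ⊥-elim (¬x (x , eq))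
  ... | yes (x , refl) =
    let s′ , s⊑s′ , y , r = forth s x
    in s′ , s⊑s′ , λ x′ eq → y , subst (λ x → R s′ x y) (sym (ιˣ.injective eq)) r

  visitʸ : ∀ n s → ∃[ s′ ] (_⊑_ R s s′ × (∀ y → ιʸ.to y ≡ n → ∃[ x ] R s′ x y))
  visitʸ n s with em {∃[ y ] ιʸ.to y ≡ n}
  ... | no  ¬y         = s , (λ _ _ → id) , λ y eq → ⊥-elim (¬y (y , eq))
  ... | yes (y , refl) =
    let s′ , s⊑s′ , x , r = back s y
    in s′ , s⊑s′ , λ y′ eq → x , subst (R s′ x) (sym (ιʸ.injective eq)) r

  chain : ℕ → S
  chain zero    = s₀
  chain (suc n) = proj₁ (visitʸ n (proj₁ (visitˣ n (chain n))))

  chain-step : ∀ n → _⊑_ R (chain n) (chain (suc n))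
  chain-step n x y r =
    proj₁ (proj₂ (visitʸ n _)) x y (proj₁ (proj₂ (visitˣ n (chain n))) x y r)

  chain-mono : ∀ {m n} → m ≤′ n → _⊑_ R (chain m) (chain n)
  chain-mono ≤′-refl       x y r = r
  chain-mono (≤′-step m≤n) x y r = chain-step _ x y (chain-mono m≤n x y r)

  W : X → Y → Set
  W x y = ∃[ n ] R (chain n) x y

  W-total : Total W
  W-total x =
    let n     = ιˣ.to x
        y , r = proj₂ (proj₂ (visitˣ n (chain n))) x refl
    -- The pair enters in the first half of step `n` and is carried through the `visitʸ` half to
    -- reach `chain (suc n)`.
    in y , suc n , proj₁ (proj₂ (visitʸ n _)) x y r

  W-onto : Onto W
  W-onto y =
    let n     = ιʸ.to y
        x , r = proj₂ (proj₂ (visitʸ n _)) y refl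
    in x , suc n , r

  -- The chain increases, so finitely many pairs of `W` lie together in the latest of their stages.
  -- Hence `W` inherits the preservation of a symbol from the stages.
  W-directed : ∀ {n} {xs : Vec X n} {ys : Vec Y n} →
    Pointwise W xs ys → ∃[ m ] Pointwise (R (chain m)) xs ys
  W-directed []             = 0 , []
  W-directed ((i , r) ∷ ws) =
    let j , rs = W-directed ws
    in i ⊔ℕ j
     , chain-mono (≤⇒≤′ (m≤m⊔n i j)) _ _ r
     ∷ Pointwise.map (chain-mono (≤⇒≤′ (m≤n⊔m i j)) _ _) rs

module _ (em : ExcludedMiddle 0ℓ) {τ} {A B : Structure τ}
         (ιᴬ : Carrier A ↣ ℕ) (ιᴮ : Carrier B ↣ ℕ)
         {S : Set} (R : S → Carrier A → Carrier B → Set) (s₀ : S)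
         (forth : Forth R) (back : Back R) where

  open Limit em ιᴬ ιᴮ R s₀ forth back

  Limit-preserves : ∀ q → (∀ s → Preserves A B (R s) q) → Preserves A B W q
  Limit-preserves (relˢ P)   pres ws = let m , rs = W-directed ws in pres (chain m) rs
  Limit-preserves (funˢ f)   pres ws = let m , rs = W-directed ws in m , pres (chain m) rs
  Limit-preserves (constˢ c) pres    = 0 , pres s₀

-- Relations between the two halves of a pair, coded by one ternary symbol

data Ternary : ℕ → Set where
  ternary : Ternary 3

ternaryRel : ∀ {U : Set} → (U → U → U → Set) → ∀ {n} → Ternary n → Vec U n → Set
ternaryRel R ternary (s ∷ x ∷ y ∷ []) = R s x y

module TernaryTheory (em : ExcludedMiddle 0ℓ) {τ : Vocabulary} where

  open ClassicalDefinability em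

  stage : (M : Structure (τ ⊎ᵥ Ternary)) → Carrier M → Carrier M → Carrier M → Set
  stage M s x y = new M ternary (s ∷ x ∷ y ∷ [])

  stageᵈ : ∀ {k} (s x y : Fin k) →
    Definable (λ M v → stage M (assign M v s) (assign M v x) (assign M v y))
  stageᵈ s x y = atomᵈ (inj₂ (inj₂ ternary)) (var s ∷ var x ∷ var y ∷ [])

  totalᵈ : Definable {k = 0} (λ M _ → ∀ s → Total (stage M s))
  totalᵈ = ∀ᵈ (∀ᵈ (∃ᵈ (stageᵈ (suc (suc zero)) (suc zero) zero)))

  ontoᵈ : Definable {k = 0} (λ M _ → ∀ s → Onto (stage M s))
  ontoᵈ = ∀ᵈ (∀ᵈ (∃ᵈ (stageᵈ (suc (suc zero)) zero (suc zero))))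

  ⊑ᵈ : ∀ {k} (s s′ : Fin k) →
    Definable (λ M v → _⊑_ (stage M) (assign M v s) (assign M v s′))
  ⊑ᵈ s s′ = ∀ᵈ (∀ᵈ (stageᵈ (suc (suc s)) (suc zero) zero →ᵈ
                    stageᵈ (suc (suc s′)) (suc zero) zero))

  forthᵈ : Definable {k = 0} (λ M _ → Forth (stage M))
  forthᵈ = ∀ᵈ (∀ᵈ (∃ᵈ (⊑ᵈ (suc (suc zero)) zero ×ᵈ
                       ∃ᵈ (stageᵈ (suc zero) (suc (suc zero)) zero))))

  backᵈ : Definable {k = 0} (λ M _ → Back (stage M))
  backᵈ = ∀ᵈ (∀ᵈ (∃ᵈ (⊑ᵈ (suc (suc zero)) zero ×ᵈ
                      ∃ᵈ (stageᵈ (suc zero) zero (suc (suc zero))))))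

  -- Variable `zero` is the stage; the other `n * 2` variables hold the two argument tuples,
  -- interleaved.
  pairwiseᵈ : ∀ n → Definable (λ M v → ∀ (i : Fin n) →
    stage M (assign M v zero) (assign M v (suc (fstᵢ i))) (assign M v (suc (sndᵢ i))))
  pairwiseᵈ n = ⋀ᵈ (λ i → stageᵈ zero (suc (fstᵢ i)) (suc (sndᵢ i)))

  module _ (M : Structure (τ ⊎ᵥ Ternary)) (s : Carrier M) where

    pairwise⇔ : ∀ n v →
      (∀ (i : Fin n) → stage M s (assign M v (fstᵢ i)) (assign M v (sndᵢ i))) ⇔
      Pointwise (stage M s) (fsts n v) (snds n v)
    pairwise⇔ zero    []          = mk⇔ (λ _ → []) (λ _ ())
    pairwise⇔ (suc n) (x ∷ y ∷ v) = mk⇔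
      (λ h → h zero ∷ to (pairwise⇔ n v) (h ∘ suc))
      (λ { (r ∷ rs) → λ { zero → r ; (suc i) → from (pairwise⇔ n v) rs i } })

    evals-fsts : ∀ n v →
      evals M (assign M (s ∷ v)) (renames inˡ (suc ∘ fstᵢ) (vars n)) ≡ fsts n v
    evals-fsts n v = trans
      (evals-renames inˡ M (suc ∘ fstᵢ) (assign-fstᵢ inˡ M n v) (vars n))
      (evals-vars (leftOf M) (fsts n v))

    evals-snds : ∀ n v →
      evals M (assign M (s ∷ v)) (renames inʳ (suc ∘ sndᵢ) (vars n)) ≡ snds n v
    evals-snds n v = trans
      (evals-renames inʳ M (suc ∘ sndᵢ) (assign-sndᵢ inʳ M n v) (vars n))
      (evals-vars (rightOf M) (snds n v))

  -- Two argument tuples amount to one interleaved vector, the form that `∀*ᵈ` quantifies over.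
  pointwise⇔ : ∀ {n} (M : Structure (τ ⊎ᵥ Ternary))
    (T : Carrier M → Vec (Carrier M) n → Vec (Carrier M) n → Set) →
    (∀ v s → (∀ (i : Fin n) → stage M s (assign M v (fstᵢ i)) (assign M v (sndᵢ i))) →
      T s (evals M (assign M (s ∷ v)) (renames inˡ (suc ∘ fstᵢ) (vars n)))
          (evals M (assign M (s ∷ v)) (renames inʳ (suc ∘ sndᵢ) (vars n)))) ⇔
    (∀ s {as bs} → Pointwise (stage M s) as bs → T s as bs)
  pointwise⇔ {n} M T = mk⇔
    (λ h s {as} {bs} rs → case interleave as bs of λ
      { (v , refl , refl) → subst₂ (T s) (evals-fsts M s n v) (evals-snds M s n v)
                              (h v s (from (pairwise⇔ M s n v) rs)) })
    (λ h v s p → subst₂ (T s) (sym (evals-fsts M s n v)) (sym (evals-snds M s n v))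
                   (h s (to (pairwise⇔ M s n v) p)))

  preservesᵈ : ∀ q →
    Definable {k = 0} (λ M _ → ∀ s → Preserves (leftOf M) (rightOf M) (stage M s) q)
  preservesᵈ (relˢ {n} P) = respᵈ
    (λ M _ → pointwise⇔ M (λ _ as bs → rel M (inj₁ P) as ⇔ rel M (inj₂ (inj₁ P)) bs))
    (∀*ᵈ (∀ᵈ (pairwiseᵈ n →ᵈ
      (atomᵈ (inj₁ P) (renames inˡ (suc ∘ fstᵢ) (vars n)) ⇔ᵈ
       atomᵈ (inj₂ (inj₁ P)) (renames inʳ (suc ∘ sndᵢ) (vars n))))))
  preservesᵈ (funˢ {n} f) = respᵈ
    (λ M _ → pointwise⇔ M (λ s as bs → stage M s (fun M (inj₁ f) as) (fun M (inj₂ f) bs)))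
    (∀*ᵈ (∀ᵈ (pairwiseᵈ n →ᵈ
      atomᵈ (inj₂ (inj₂ ternary))
        (var zero ∷ app (inj₁ f) (renames inˡ (suc ∘ fstᵢ) (vars n))
                  ∷ app (inj₂ f) (renames inʳ (suc ∘ sndᵢ) (vars n)) ∷ []))))
  preservesᵈ (constˢ c) =
    ∀ᵈ (atomᵈ (inj₂ (inj₂ ternary)) (var zero ∷ con (inj₁ c) ∷ con (inj₂ c) ∷ []))

Preserves-pullback : ∀ {τ} (A B : Structure τ) {C : Set} (c : C) {W} q → Preserves A B W q →
  Preserves (fstPullback A B c) (sndPullback A B c) (λ x y → W (proj₁ x) (proj₁ (proj₂ y))) q
Preserves-pullback A B c (relˢ P)   pres ws = pres (Pointwise.map⁺ id ws)
Preserves-pullback A B c (funˢ f)   pres ws = pres (Pointwise.map⁺ id ws)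
Preserves-pullback A B c (constˢ d) pres    = pres

-- Uniform back-and-forth axioms

-- One symbol for each length, so that finitely many axioms can be met by a linking that demands
-- less and less agreement as tuples grow.
data Tuple : ℕ → Set where
  tuple : ∀ k → Tuple (k * 2)

-- Function symbols have no axiom of their own: `agreeᵃ` ranges over atoms with arbitrary terms.
data Axiom (τ : Vocabulary) : Set where
  startᵃ : Axiom τ
  forthᵃ : ℕ → Axiom τ
  backᵃ  : ℕ → Axiom τ
  agreeᵃ : ∀ k {n} → Rel τ n → Vec (Term τ k) n → Axiom τ

module TupleTheory (em : ExcludedMiddle 0ℓ) {τ : Vocabulary} where

  open ClassicalDefinability em

  module _ (M : Structure (τ ⊎ᵥ Tuple)) where

    Linked : ∀ k → Vec (Carrier M) (k * 2) → Set
    Linked k v = new M (tuple k) v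

    Holds : Axiom τ → Set
    Holds startᵃ     = Linked 0 []
    Holds (forthᵃ k) = ∀ v → Linked k v → ∀ a → ∃[ b ] Linked (suc k) (a ∷ b ∷ v)
    Holds (backᵃ k)  = ∀ v → Linked k v → ∀ b → ∃[ a ] Linked (suc k) (a ∷ b ∷ v)
    Holds (agreeᵃ k P ts) = ∀ v → Linked k v →
      rel (leftOf M) P (evals (leftOf M) (assign (leftOf M) (fsts k v)) ts) ⇔
      rel (rightOf M) P (evals (rightOf M) (assign (rightOf M) (snds k v)) ts)

  linkedᵈ : ∀ k → Definable (λ M v → Linked M k v)
  linkedᵈ k = respᵈ (λ M v → ≡⇒⇔ (cong (new M (tuple k)) (evals-vars M v)))
    (atomᵈ (inj₂ (inj₂ (tuple k))) (vars (k * 2)))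

  linkedʳᵈ : ∀ k {m} (g : Fin (k * 2) → Fin m) (p : ∀ {X : Set} → Vec X m → Vec X (k * 2)) →
    (∀ M v i → assign {τ ⊎ᵥ Tuple} M v (g i) ≡ assign M (p v) i) →
    Definable (λ M v → Linked M k (p v))
  linkedʳᵈ k g p eq = respᵈ
    (λ M v → ≡⇒⇔ (cong (new M (tuple k))
      (trans (evals-renames idᵥ M g (eq M v) (vars (k * 2))) (evals-vars M (p v)))))
    (atomᵈ (inj₂ (inj₂ (tuple k))) (renames idᵥ g (vars (k * 2))))

  swap₂ : ∀ {X : Set} {m} → Vec X (2 + m) → Vec X (2 + m)
  swap₂ (x ∷ y ∷ v) = y ∷ x ∷ v

  swapᵢ : ∀ {m} → Fin (2 + m) → Fin (2 + m)
  swapᵢ zero          = suc zero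
  swapᵢ (suc zero)    = zero
  swapᵢ (suc (suc i)) = suc (suc i)

  assign-swap : ∀ {m} (M : Structure (τ ⊎ᵥ Tuple)) (v : Vec (Carrier M) (2 + m)) i →
    assign M v (swapᵢ i) ≡ assign M (swap₂ v) i
  assign-swap M (x ∷ y ∷ v) zero          = refl
  assign-swap M (x ∷ y ∷ v) (suc zero)    = refl
  assign-swap M (x ∷ y ∷ v) (suc (suc i)) = refl

  holdsᵈ : ∀ i → Definable {k = 0} (λ M _ → Holds M i)
  holdsᵈ startᵃ     = respᵈ (λ M → λ { [] → ⇔-id _ }) (linkedᵈ 0)
  -- The quantifiers `∀ a ∃ b` put `b` in front of `a`, while linked tuples list `a` first; hence
  -- the swap, absent from `backᵃ`.
  holdsᵈ (forthᵃ k) = ∀*ᵈ (linkedᵈ k →ᵈ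
    ∀ᵈ (∃ᵈ (linkedʳᵈ (suc k) swapᵢ swap₂ assign-swap)))
  holdsᵈ (backᵃ k)  = ∀*ᵈ (linkedᵈ k →ᵈ ∀ᵈ (∃ᵈ (linkedᵈ (suc k))))
  holdsᵈ (agreeᵃ k P ts) = ∀*ᵈ (linkedᵈ k →ᵈ
    (respᵈ (λ M v → ≡⇒⇔ (cong (rel M (inj₁ P))
        (evals-renames inˡ M fstᵢ (assign-fstᵢ inˡ M k v) ts)))
      (atomᵈ (inj₁ P) (renames inˡ fstᵢ ts)) ⇔ᵈ
     respᵈ (λ M v → ≡⇒⇔ (cong (rel M (inj₂ (inj₁ P)))
        (evals-renames inʳ M sndᵢ (assign-sndᵢ inʳ M k v) ts)))
      (atomᵈ (inj₂ (inj₁ P)) (renames inʳ sndᵢ ts))))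

-- A linked tuple relates the values of each term on its two halves; taking all
-- terms makes each stage closed under the functions, whatever their number.

module TermSystem {τ : Vocabulary} (em : ExcludedMiddle 0ℓ) (M : Structure (τ ⊎ᵥ Tuple))
                  (holds : ∀ i → TupleTheory.Holds em M i) where

  open TupleTheory em

  A B : Structure τ
  A = leftOf M
  B = rightOf M

  LinkedTuple : Set
  LinkedTuple = Σ[ k ∈ ℕ ] Σ[ v ∈ Vec (Carrier M) (k * 2) ] Linked M k v

  R : LinkedTuple → Carrier A → Carrier B → Set
  R (k , v , _) x y = Σ[ t ∈ Term τ k ]
    eval A (assign A (fsts k v)) t ≡ x × eval B (assign B (snds k v)) t ≡ y

  R-weaken : ∀ {k v l a b l′} → _⊑_ R (k , v , l) (suc k , a ∷ b ∷ v , l′)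
  R-weaken x y (t , eqᴬ , eqᴮ) = rename idᵥ suc t
    , trans (eval-rename idᵥ A suc (λ _ → refl) t) eqᴬ
    , trans (eval-rename idᵥ B suc (λ _ → refl) t) eqᴮ

  R-start : LinkedTuple
  R-start = 0 , [] , holds startᵃ

  R-forth : Forth R
  R-forth (k , v , l) a =
    let b , l′ = holds (forthᵃ k) v l a
    in (suc k , a ∷ b ∷ v , l′) , R-weaken {l = l} {l′ = l′} , b , var zero , refl , refl

  R-back : Back R
  R-back (k , v , l) b =
    let a , l′ = holds (backᵃ k) v l b
    in (suc k , a ∷ b ∷ v , l′) , R-weaken {l = l} {l′ = l′} , a , var zero , refl , refl

  R-terms : ∀ ((k , v , l) : LinkedTuple) {n} {xs : Vec (Carrier A) n} {ys : Vec (Carrier B) n} →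
    Pointwise (R (k , v , l)) xs ys → Σ[ ts ∈ Vec (Term τ k) n ]
      evals A (assign A (fsts k v)) ts ≡ xs × evals B (assign B (snds k v)) ts ≡ ys
  R-terms s []                      = [] , refl , refl
  R-terms s ((t , refl , refl) ∷ rs) with R-terms s rs
  ... | ts , refl , refl = t ∷ ts , refl , refl

  R-preserves : ∀ s q → Preserves A B (R s) q
  R-preserves s@(k , v , l) (relˢ P) rs with R-terms s rs
  ... | ts , refl , refl = holds (agreeᵃ k P ts) v l
  R-preserves s (funˢ f) rs with R-terms s rs
  ... | ts , refl , refl = app f ts , refl , refl
  R-preserves s (constˢ c) = con c , refl , refl

-- Hintikka formulas

module _ {τ : Vocabulary} where

  AgreeOn : ∀ {k} (A B : Structure τ) → List (Formula τ k) →
    Assignment A k → Assignment B k → Set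
  AgreeOn A B Ψ ρ ρ′ = All (λ ψ → satisfies A ρ ψ ⇔ satisfies B ρ′ ψ) Ψ

  -- One conjunction for each choice of signs on `Ψ`, so that two tuples satisfying the same pattern
  -- agree on all of `Ψ`.
  patterns : ∀ {k} → List (Formula τ k) → List (Formula τ k)
  patterns []      = neg falsum ∷ []
  patterns (ψ ∷ Ψ) = map (conj ψ) (patterns Ψ) ++ map (conj (neg ψ)) (patterns Ψ)

  module _ (em : ExcludedMiddle 0ℓ) where

    pattern-of : ∀ {k} (A : Structure τ) (ρ : Assignment A k) Ψ →
      ∃[ π ] π ∈ᴸ patterns Ψ × satisfies A ρ π
    pattern-of A ρ []      = neg falsum , here refl , λ ()
    pattern-of A ρ (ψ ∷ Ψ) with pattern-of A ρ Ψ | em {satisfies A ρ ψ}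
    ... | π , π∈ , p | yes q = conj ψ π , ∈-++⁺ˡ (∈-map⁺ (conj ψ) π∈) , q , p
    ... | π , π∈ , p | no ¬q =
      conj (neg ψ) π , ∈-++⁺ʳ (map (conj ψ) (patterns Ψ)) (∈-map⁺ (conj (neg ψ)) π∈) , ¬q , p

  pattern-agree : ∀ {k} (A B : Structure τ) {ρ : Assignment A k} {ρ′ : Assignment B k} Ψ {π} →
    π ∈ᴸ patterns Ψ → satisfies A ρ π → satisfies B ρ′ π → AgreeOn A B Ψ ρ ρ′
  pattern-agree A B []      π∈ p p′ = []
  pattern-agree A B (ψ ∷ Ψ) π∈ p p′ with ∈-++⁻ (map (conj ψ) (patterns Ψ)) π∈
  ... | inj₁ π∈ˡ with ∈-map⁻ (conj ψ) π∈ˡ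
  ...   | π , π∈′ , refl =
    mk⇔ (λ _ → proj₁ p′) (λ _ → proj₁ p) ∷ pattern-agree A B Ψ π∈′ (proj₂ p) (proj₂ p′)
  pattern-agree A B (ψ ∷ Ψ) π∈ p p′ | inj₂ π∈ʳ with ∈-map⁻ (conj (neg ψ)) π∈ʳ
  ...   | π , π∈′ , refl =
    mk⇔ (⊥-elim ∘ proj₁ p) (⊥-elim ∘ proj₁ p′) ∷ pattern-agree A B Ψ π∈′ (proj₂ p) (proj₂ p′)

  atomAt : ∀ k → Axiom τ → List (Formula τ k)
  atomAt k (agreeᵃ k′ P ts) with k ≟ k′
  ... | yes refl = atom P ts ∷ []
  ... | no  _    = []
  atomAt k _ = []

  ∈-atomAt : ∀ k {n} (P : Rel τ n) ts → atom P ts ∈ᴸ atomAt k (agreeᵃ k P ts)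
  ∈-atomAt k P ts with k ≟ k
  ... | yes refl = here refl
  ... | no k≢k   = ⊥-elim (k≢k refl)

  -- The length of the tuples whose existence the axiom demands of an extension; `startᵃ` and
  -- `agreeᵃ` extend nothing.
  level : Axiom τ → ℕ
  level (forthᵃ k) = suc k
  level (backᵃ k)  = suc k
  level _         = 0

  module _ (is : List (Axiom τ)) where

    -- Agreement on this list is equivalence for `d` rounds of the back-and-forth game, with only
    -- the atoms mentioned in `is`; this keeps the list finite over any vocabulary.
    hintikka : ℕ → ∀ k → List (Formula τ k)
    hintikka zero    k = concatMap (atomAt k) is
    hintikka (suc d) k = concatMap (atomAt k) is ++ map ex (patterns (hintikka d (suc k)))

    atom∈hintikka : ∀ d {k n} {P : Rel τ n} {ts} →
      agreeᵃ k P ts ∈ᴸ is → atom P ts ∈ᴸ hintikka d k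
    atom∈hintikka zero    i∈ = ∈-concatMap⁺ (atomAt _) (Any.map (λ { refl → ∈-atomAt _ _ _ }) i∈)
    atom∈hintikka (suc d) i∈ =
      ∈-++⁺ˡ (∈-concatMap⁺ (atomAt _) (Any.map (λ { refl → ∈-atomAt _ _ _ }) i∈))

    ex∈hintikka : ∀ d {k π} → π ∈ᴸ patterns (hintikka d (suc k)) → ex π ∈ᴸ hintikka (suc d) k
    ex∈hintikka d π∈ = ∈-++⁺ʳ (concatMap (atomAt _) is) (∈-map⁺ ex π∈)

    module _ (em : ExcludedMiddle 0ℓ) (A B : Structure τ) {k}
             {ρ : Assignment A k} {ρ′ : Assignment B k} (d : ℕ) where

      -- The existence of an element with the pattern of `a` is itself a formula of rank `suc d`, so
      -- the other side has such an element too.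
      hintikka-forth : AgreeOn A B (hintikka (suc d) k) ρ ρ′ → ∀ a →
        ∃[ b ] AgreeOn A B (hintikka d (suc k)) (extend A a ρ) (extend B b ρ′)
      hintikka-forth agrees a =
        let π , π∈ , p = pattern-of em A (extend A a ρ) (hintikka d (suc k))
            b , p′     = to (All.lookup agrees (ex∈hintikka d π∈)) (a , p)
        in b , pattern-agree A B _ π∈ p p′

      hintikka-back : AgreeOn A B (hintikka (suc d) k) ρ ρ′ → ∀ b →
        ∃[ a ] AgreeOn A B (hintikka d (suc k)) (extend A a ρ) (extend B b ρ′)
      hintikka-back agrees b =
        let π , π∈ , p = pattern-of em B (extend B b ρ′) (hintikka d (suc k))
            a , p′     = from (All.lookup agrees (ex∈hintikka d π∈)) (b , p)
        in a , pattern-agree A B _ π∈ p′ p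

    depth : ℕ
    depth = max 0 (map level is)

    level≤depth : ∀ {i} → i ∈ᴸ is → level i ≤ depth
    level≤depth i∈ = All.lookup (xs≤max 0 (map level is)) (∈-map⁺ level i∈)

    -- A tuple of length `k` has used `k` of the `depth` rounds. From length `depth` on, truncated
    -- subtraction leaves only atoms, and no axiom in `is` asks for an extension there.
    hintikkaAt : ∀ k → List (Formula τ k)
    hintikkaAt k = hintikka (depth ∸ k) k

-- Compactness and the Löwenheim–Skolem property

module Lindström {v} (em : ExcludedMiddle (lsuc 0ℓ ⊔ v)) (L : Logic v)
                 (isAbstractLogic : IsAbstractLogic L) (FO≤L : 𝓛⁻ωω ≤ᴸ L)
                 (weakIso : WeakIsomorphismProperty L) (compact : CompactnessProperty L)
                 (löwenheimSkolem : LöwenheimSkolemProperty L) where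

  open Logic L
  open IsAbstractLogic isAbstractLogic

  em₀ : ExcludedMiddle 0ℓ
  em₀ {P} = map′ lower lift (em {Lift (lsuc 0ℓ ⊔ v) P})

  emᵛ : ExcludedMiddle v
  emᵛ {P} = map′ lower lift (em {Lift (lsuc 0ℓ ⊔ v) P})

  open TernaryTheory em₀

  module _ {τ : Vocabulary} (φ : Sentence τ) where

    Transfers : ∀ {X} → Structure (τ ⊎ᵥ X) → Set v
    Transfers M = leftOf M ⊨ φ → rightOf M ⊨ φ

    -- A failure of `Transfers` becomes a single sentence of `L`, to which compactness and
    -- Löwenheim-Skolem can be applied.
    separating : ∀ X → Σ[ ψ ∈ Sentence (τ ⊎ᵥ X) ] (∀ M → M ⊨ ψ ⇔ (leftOf M ⊨ φ × ¬ (rightOf M ⊨ φ)))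
    separating X =
      let φˡ , φˡ⇔   = translation inˡ φ
          φʳ , φʳ⇔   = translation inʳ φ
          ¬φʳ , ¬φʳ⇔ = negation φʳ
          ψ , ψ⇔     = conjunction φˡ ¬φʳ
      in ψ , λ M → (φˡ⇔ M ×-⇔ (→-cong-⇔ (φʳ⇔ M) (⇔-id ⊥) ⇔-∘ ¬φʳ⇔ M)) ⇔-∘ ψ⇔ M

    ¬separating⇒transfers : ∀ {X} (M : Structure (τ ⊎ᵥ X)) →
      ¬ (leftOf M ⊨ φ × ¬ (rightOf M ⊨ φ)) → Transfers M
    ¬separating⇒transfers M ¬sep p = decidable-stable emᵛ (λ ¬q → ¬sep (p , ¬q))

    -- If no finite list sufficed, the axioms together with the separating sentence would be
    -- finitely satisfiable; by compactness they would have a model, against `transfers`.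
    finite-consequence : ∀ {X} {I : Set}
      {Q : I → (M : Structure (τ ⊎ᵥ X)) → Vec (Carrier M) 0 → Set} →
      (∀ i → Definable (Q i)) → (∀ M → (∀ i → Q i M []) → Transfers M) →
      Σ[ is ∈ List I ] (∀ M → All (λ i → Q i M []) is → Transfers M)
    finite-consequence {X} {I} {Q} D transfers = decidable-stable em ¬¬finite
      where
      Good : List I → Set (lsuc 0ℓ ⊔ v)
      Good is = ∀ M → All (λ i → Q i M []) is → Transfers M

      Separated : (Structure (τ ⊎ᵥ X) → Set) → Set (lsuc 0ℓ ⊔ v)
      Separated K = Σ[ M ∈ _ ] K M × leftOf M ⊨ φ × ¬ (rightOf M ⊨ φ)

      axiom : I → Sentence (τ ⊎ᵥ X)
      axiom i = proj₁ (FO≤L (formula (D i)))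

      axiom⇔ : ∀ i M → M ⊨ axiom i ⇔ Q i M []
      axiom⇔ i M = defines (D i) M [] ⇔-∘ ⇔-sym (proj₂ (FO≤L (formula (D i))) M)

      sep : Sentence (τ ⊎ᵥ X)
      sep = proj₁ (separating X)

      Φ : Pred (Sentence (τ ⊎ᵥ X)) 0ℓ
      Φ ψ = sep ≡ ψ ⊎ (∃[ i ] axiom i ≡ ψ)

      indices : ∀ {Γ} → All (_∈ Φ) Γ → List I
      indices []                  = []
      indices (inj₁ _ ∷ Γ⊆Φ)       = indices Γ⊆Φ
      indices (inj₂ (i , _) ∷ Γ⊆Φ) = i ∷ indices Γ⊆Φ

      models : ∀ {Γ M} (Γ⊆Φ : All (_∈ Φ) Γ) → All (λ i → Q i M []) (indices Γ⊆Φ) →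
        M ⊨ sep → All (M ⊨_) Γ
      models []                     qs       s = []
      models (inj₁ refl ∷ Γ⊆Φ)       qs       s = s ∷ models Γ⊆Φ qs s
      models (inj₂ (i , refl) ∷ Γ⊆Φ) (q ∷ qs) s = from (axiom⇔ i _) q ∷ models Γ⊆Φ qs s

      ¬¬finite : ¬ ¬ Σ (List I) Good
      ¬¬finite ¬finite =
        let M , M⊨Φ = compact Φ (λ Γ Γ⊆Φ → finitely-satisfiable Γ⊆Φ)
            p , ¬q  = to (proj₂ (separating X) M) (M⊨Φ sep (inj₁ refl))
        in ¬q (transfers M (λ i → to (axiom⇔ i M) (M⊨Φ (axiom i) (inj₂ (i , refl)))) p)
        where
        separated : ∀ is → Separated (λ M → All (λ i → Q i M []) is)
        separated is = decidable-stable em λ ¬sep → ¬finite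
          (is , λ M qs → ¬separating⇒transfers M (λ s → ¬sep (M , qs , s)))

        finitely-satisfiable : ∀ {Γ} → All (_∈ Φ) Γ → Σ[ M ∈ Structure (τ ⊎ᵥ X) ] All (M ⊨_) Γ
        finitely-satisfiable Γ⊆Φ =
          let M , qs , s = separated (indices Γ⊆Φ)
          in M , models Γ⊆Φ qs (from (proj₂ (separating X) M) s)

    -- A counterexample satisfies the separating sentence and the sentence for `Q`; Löwenheim-Skolem
    -- applied to their conjunction gives a countable counterexample.
    countable-suffices : ∀ {X} {Q : (M : Structure (τ ⊎ᵥ X)) → Vec (Carrier M) 0 → Set} →
      Definable Q → (∀ M → Countable (Carrier M) → Q M [] → Transfers M) →
      ∀ M → Infinite (Carrier M) → Q M [] → Transfers M
    countable-suffices {X} {Q} D transfers M infinite q =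
      ¬separating⇒transfers M λ s →
        let N , countable , N⊨χ = löwenheimSkolem χ
              (M , infinite , from (χ⇔ M) (from (ψ⇔ M) s , from (θ⇔ M) (from (defines D M []) q)))
            N⊨ψ , N⊨θ = to (χ⇔ N) N⊨χ
            p , ¬p′   = to (ψ⇔ N) N⊨ψ
        in ¬p′ (transfers N countable (to (defines D N []) (to (θ⇔ N) N⊨θ)) p)
      where
      ψ  = proj₁ (separating X)
      ψ⇔ = proj₂ (separating X)
      θ  = proj₁ (FO≤L (formula D))
      θ⇔ : ∀ M → M ⊨ θ ⇔ satisfies M (empty M) (formula D)
      θ⇔ M = ⇔-sym (proj₂ (FO≤L (formula D)) M)
      χ  = proj₁ (conjunction ψ θ)
      χ⇔ = proj₂ (conjunction ψ θ)

    transfers-twin : ∀ (A B : Structure τ) {C : Set} (c : C) {X : ℕ → Set}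
      (E : ∀ {n} → X n → Vec (Carrier A × Carrier B × C) n → Set) →
      Transfers (twin A B c {X} E) → A ⊨ φ → B ⊨ φ
    transfers-twin A B c E transfers =
      from (weakIso (∼-sndPullback A B c) φ) ∘ transfers ∘ to (weakIso (∼-fstPullback A B c) φ)

    -- Preservation of all symbols makes `W` a weak isomorphism, so `φ` transfers;
    -- `finite-consequence` leaves finitely many symbols.
    finite-dependence : Σ[ qs ∈ List (Symbol τ) ] (∀ {A B : Structure τ} {W} →
      Total W → Onto W → All (Preserves A B W) qs → A ⊨ φ → B ⊨ φ)
    finite-dependence = catMaybes is , λ {A} {B} {W} total onto pres →
      -- The stage argument is a dummy here: every stage names the same relation `W`.
      transfers-twin A B tt {Ternary} (ternaryRel (λ s x y → W (proj₁ x) (proj₁ (proj₂ y))))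
        (is-suffice _ (clauses A B total onto is pres))
      where
      -- The index `nothing` stands for totality and surjectivity, which are assumed of `W` anyway
      -- and so are dropped by `catMaybes`.
      Clause : Maybe (Symbol τ) → (M : Structure (τ ⊎ᵥ Ternary)) → Vec (Carrier M) 0 → Set
      Clause nothing  M _ = (∀ s → Total (stage M s)) × (∀ s → Onto (stage M s))
      Clause (just q) M _ = ∀ s → Preserves (leftOf M) (rightOf M) (stage M s) q

      clauseᵈ : ∀ i → Definable (Clause i)
      clauseᵈ nothing  = totalᵈ ×ᵈ ontoᵈ
      clauseᵈ (just q) = preservesᵈ q

      weakly-isomorphic : ∀ M → (∀ i → Clause i M []) → Transfers M
      weakly-isomorphic M h =
        let total , onto = h nothing
            s            = inhabitant M
        in to (weakIso (stage M s , weakIsomorphism (total s) (onto s) (λ q → h (just q) s)) φ)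

      is         = proj₁ (finite-consequence clauseᵈ weakly-isomorphic)
      is-suffice = proj₂ (finite-consequence clauseᵈ weakly-isomorphic)

      module _ (A B : Structure τ) {W : Carrier A → Carrier B → Set}
               (total : Total W) (onto : Onto W) where

        M : Structure (τ ⊎ᵥ Ternary)
        M = twin A B tt (ternaryRel (λ s x y → W (proj₁ x) (proj₁ (proj₂ y))))

        clauses : ∀ is → All (Preserves A B W) (catMaybes is) → All (λ i → Clause i M []) is
        clauses []             []       = []
        clauses (nothing ∷ is) ps       =
          ( (λ _ x → let b , w = total (proj₁ x) in (inhabitant A , b , tt) , w)
          , (λ _ y → let a , w = onto (proj₁ (proj₂ y)) in (a , inhabitant B , tt) , w)
          ) ∷ clauses is ps
        clauses (just q ∷ is)  (p ∷ ps) = (λ _ → Preserves-pullback A B tt q p) ∷ clauses is ps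

    -- Only the symbols from `finite-dependence` enter `Theory`, which is thus one sentence. In a
    -- countable model of it, `Limit` yields a total and onto relation preserving these symbols.
    partially-isomorphic : (A B : Structure τ) {S : Set} (R : S → Carrier A → Carrier B → Set) →
      S → Forth R → Back R → (∀ s q → Preserves A B (R s) q) → A ⊨ φ → B ⊨ φ
    partially-isomorphic A B {S} R s₀ forth back pres =
      transfers-twin A B (0 , s₀) {Ternary} (ternaryRel R⁺)
        (countable-suffices theoryᵈ countable-case (twin A B (0 , s₀) (ternaryRel R⁺)) infinite
          (forth⁺ , back⁺ , All.universal
            (λ q s → Preserves-pullback A B (0 , s₀) q (pres (stageOf s) q)) qs))
      where
      qs = proj₁ finite-dependence
      U  = Carrier A × Carrier B × ℕ × S

      Theory : (M : Structure (τ ⊎ᵥ Ternary)) → Vec (Carrier M) 0 → Set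
      Theory M _ = Forth (stage M) × Back (stage M) ×
        All (λ q → ∀ s → Preserves (leftOf M) (rightOf M) (stage M s) q) qs

      theoryᵈ : Definable Theory
      theoryᵈ = forthᵈ ×ᵈ (backᵈ ×ᵈ Allᵈ preservesᵈ qs)

      countable-case : ∀ M → Countable (Carrier M) → Theory M [] → Transfers M
      -- In `M` every element names a stage, so the chain may start at any of them.
      countable-case M ι (f , b , ps) = proj₂ finite-dependence W-total W-onto
        (All.map (λ {q} → Limit-preserves em₀ ι ι (stage M) (inhabitant M) f b q) ps)
        where open Limit em₀ ι ι (stage M) (inhabitant M) f b

      stageOf : U → S
      stageOf u = proj₂ (proj₂ (proj₂ u))

      R⁺ : U → U → U → Set
      R⁺ u x y = R (stageOf u) (proj₁ x) (proj₁ (proj₂ y))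

      forth⁺ : Forth R⁺
      forth⁺ (a , b , n , s) x =
        let s′ , s⊑s′ , y , r = forth s (proj₁ x)
        in (a , b , n , s′) , (λ _ _ → s⊑s′ _ _) , (inhabitant A , y , n , s) , r

      back⁺ : Back R⁺
      back⁺ (a , b , n , s) y =
        let s′ , s⊑s′ , x , r = back s (proj₁ (proj₂ y))
        in (a , b , n , s′) , (λ _ _ → s⊑s′ _ _) , (x , inhabitant B , n , s) , r

      infinite : Infinite U
      infinite (n , U↔Fin) = 1+n≰n (injective⇒≤ {f = f} f-injective)
        where
        f : Fin (suc n) → Fin n
        f i = Inverse.to U↔Fin (inhabitant A , inhabitant B , toℕ i , s₀)
        f-injective : ∀ {i j} → f i ≡ f j → i ≡ j
        f-injective eq =
          toℕ-injective (cong (λ u → proj₁ (proj₂ (proj₂ u))) (Injection.injective (↔⇒↣ U↔Fin) eq))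

    -- Agreement on finitely many first-order sentences

    module _ (is : List (Axiom τ)) (A B : Structure τ) where

      open TupleTheory em₀

      private
        A⁺ = fstPullback A B tt
        B⁺ = sndPullback A B tt

      agreement : ∀ {n} → Tuple n → Vec (Carrier A × Carrier B × ⊤) n → Set
      agreement (tuple k) v =
        AgreeOn A⁺ B⁺ (hintikkaAt is k) (assign A⁺ (fsts k v)) (assign B⁺ (snds k v))

      -- Below `depth` a round is left; this exposes the successor consumed by `hintikka-forth` and
      -- `hintikka-back`.
      agreement-suc : ∀ {k v} → suc k ≤ depth is → agreement (tuple k) v →
        AgreeOn A⁺ B⁺ (hintikka is (suc (depth is ∸ suc k)) k)
                      (assign A⁺ (fsts k v)) (assign B⁺ (snds k v))
      agreement-suc {k} {v} k< = subst
        (λ d → AgreeOn A⁺ B⁺ (hintikka is d k) (assign A⁺ (fsts k v)) (assign B⁺ (snds k v)))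
        (+-∸-assoc 1 k<)

      hintikka-holds : AgreeOn A⁺ B⁺ (hintikkaAt is 0) (empty A⁺) (empty B⁺) →
        All (Holds (twin A B tt agreement)) is
      hintikka-holds agrees = All.tabulate (λ {i} → holds i)
        where
        holds : ∀ i → i ∈ᴸ is → Holds (twin A B tt agreement) i
        holds startᵃ          i∈     = agrees
        holds (forthᵃ k)      i∈ v l = hintikka-forth is em₀ A⁺ B⁺ (depth is ∸ suc k)
          (agreement-suc {k} {v} (level≤depth is i∈) l)
        holds (backᵃ k)       i∈ v l = hintikka-back is em₀ A⁺ B⁺ (depth is ∸ suc k)
          (agreement-suc {k} {v} (level≤depth is i∈) l)
        holds (agreeᵃ k P ts) i∈ v l = All.lookup l (atom∈hintikka is (depth is ∸ k) i∈)

    -- All tuple axioms together give a back-and-forth system, so finitely many already transfer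
    -- `φ`. These hold in the twin linked by `agreement`, once the empty tuples agree.
    finite-agreement : Σ[ Ψ ∈ List (Formula τ 0) ] (∀ A B →
      AgreeOn A B Ψ (empty A) (empty B) → A ⊨ φ → B ⊨ φ)
    finite-agreement = hintikkaAt is 0 , λ A B agrees →
      transfers-twin A B tt {Tuple} (agreement is A B)
        (is-suffice _ (hintikka-holds is A B (All.map (λ {ψ} → lift-agreement A B ψ) agrees)))
      where
      open TupleTheory em₀

      models-transfer : ∀ (M : Structure (τ ⊎ᵥ Tuple)) → (∀ i → Holds M i) → Transfers M
      models-transfer M holds =
        partially-isomorphic (leftOf M) (rightOf M) R R-start R-forth R-back R-preserves
        where open TermSystem {τ} em₀ M holds

      is         = proj₁ (finite-consequence holdsᵈ models-transfer)
      is-suffice = proj₂ (finite-consequence holdsᵈ models-transfer)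

      -- Inherited from `L` through `FO≤L`, without induction on `ψ`.
      first-order-invariant : ∀ {A B : Structure τ} → A ∼ B → ∀ ψ →
        satisfies A (empty A) ψ ⇔ satisfies B (empty B) ψ
      first-order-invariant {A} {B} A∼B ψ =
        let ψ′ , ψ⇔ = FO≤L ψ in ⇔-sym (ψ⇔ B) ⇔-∘ (weakIso A∼B ψ′ ⇔-∘ ψ⇔ A)

      lift-agreement : ∀ A B ψ → satisfies A (empty A) ψ ⇔ satisfies B (empty B) ψ →
        satisfies (fstPullback A B tt) (empty _) ψ ⇔ satisfies (sndPullback A B tt) (empty _) ψ
      lift-agreement A B ψ h =
        first-order-invariant (∼-sndPullback A B tt) ψ ⇔-∘ (h ⇔-∘
        ⇔-sym (first-order-invariant (∼-fstPullback A B tt) ψ))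

    -- The class K records the truth values of the formulas already split on.
    invariant⇒first-order : ∀ (Ψ : List (Formula τ 0)) (K : Structure τ → Set) →
      (∀ A B → K A → K B → AgreeOn A B Ψ (empty A) (empty B) → A ⊨ φ → B ⊨ φ) →
      Σ[ χ ∈ Formula τ 0 ] (∀ A → K A → A ⊨ φ ⇔ satisfies A (empty A) χ)
    -- With nothing left to split on, all members of `K` agree on `φ`, so a truth constant defines
    -- it there.
    invariant⇒first-order [] K inv with em {Σ[ A ∈ Structure τ ] K A × A ⊨ φ}
    ... | yes (A , k , p) =
      neg falsum , λ B k′ → mk⇔ (λ _ ()) (λ _ → inv A B k k′ [] p)
    ... | no ¬p = falsum , λ B k′ → mk⇔ (λ p → ¬p (B , k′ , p)) ⊥-elim
    invariant⇒first-order (ψ ∷ Ψ) K inv = χ , λ A k → mk⇔ (χ-sound A k) (χ-complete A k)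
      where
      sat : Formula τ 0 → Structure τ → Set
      sat ψ A = satisfies A (empty A) ψ

      case⁺ = invariant⇒first-order Ψ (λ A → K A × sat ψ A)
        (λ A B (k , s) (k′ , s′) agrees → inv A B k k′ (mk⇔ (λ _ → s′) (λ _ → s) ∷ agrees))
      case⁻ = invariant⇒first-order Ψ (λ A → K A × ¬ sat ψ A)
        (λ A B (k , s) (k′ , s′) agrees →
          inv A B k k′ (mk⇔ (⊥-elim ∘ s) (⊥-elim ∘ s′) ∷ agrees))

      χ⁺ = proj₁ case⁺
      χ⁻ = proj₁ case⁻

      χ : Formula τ 0
      -- Definition by cases: `χ⁺` where `ψ` holds, `χ⁻` where it fails.
      χ = conj (neg (conj ψ (neg χ⁺))) (neg (conj (neg ψ) (neg χ⁻)))

      χ-sound : ∀ A → K A → A ⊨ φ → sat χ A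
      χ-sound A k p = (λ (s , ¬χ⁺) → ¬χ⁺ (to (proj₂ case⁺ A (k , s)) p))
                    , (λ (s , ¬χ⁻) → ¬χ⁻ (to (proj₂ case⁻ A (k , s)) p))

      χ-complete : ∀ A → K A → sat χ A → A ⊨ φ
      χ-complete A k (h⁺ , h⁻) with em₀ {sat ψ A}
      ... | yes s = from (proj₂ case⁺ A (k , s)) (decidable-stable em₀ (λ ¬χ⁺ → h⁺ (s , ¬χ⁺)))
      ... | no  s = from (proj₂ case⁻ A (k , s)) (decidable-stable em₀ (λ ¬χ⁻ → h⁻ (s , ¬χ⁻)))

    first-order : Σ[ χ ∈ Formula τ 0 ] (∀ A → A ⊨ φ ⇔ satisfies A (empty A) χ)
    first-order =
      let Ψ , inv = finite-agreement
          χ , χ⇔  = invariant⇒first-order Ψ (λ _ → ⊤) (λ A B _ _ → inv A B)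
      in χ , λ A → χ⇔ A tt

theorem6 : ∀ {v} → ExcludedMiddle (lsuc 0ℓ ⊔ v) →
    (L : Logic v) → IsAbstractLogic L → 𝓛⁻ωω ≤ᴸ L →
    WeakIsomorphismProperty L → CompactnessProperty L →
    LöwenheimSkolemProperty L →
    L ≤ᴸ 𝓛⁻ωω
theorem6 em L isL FO≤L weakIso compact ls =
  Lindström.first-order em L isL FO≤L weakIso compact ls
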